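{- Let $(C,e,\lambda,\oplus)$ be a Catalan structure, and let $\gamma$ and $\ominus$ be the derived secondary operations on $C$. Then the quadruple $(C,e,\gamma,\ominus)$ is itself a Catalan structure.
   Context: A Catalan structure is a quadruple $(C,e,\lambda,\oplus)$ where $C=\bigsqcup_{n\ge 0}C_n$ with $C_0=\{e\}$ ($|t|=n$ for $t\in C_n$), $\lambda\colon C_n\to C_{n+1}$, $\oplus\colon C_m\times C_n\to C_{m+n}$, $\oplus$ is associative with two-sided identity $e$, and every $t\in C$ can be written uniquely in exactly one of three forms: $t=e$; $t=\lambda(s)$ with $s\in C$ (indecomposable); $t=u\oplus v$ with $u$ indecomposable and $v\in C\setminus C_0$ (decomposable). Secondary operations: $\gamma(t)=t\oplus\lambda(e)$, and $\ominus$ is defined by recursion on the first argument by $e\ominus v=v$, $\lambda(u)\ominus v=\lambda(u\ominus v)$, $(t\oplus u)\ominus v=t\oplus(u\ominus v)$ for $t,u\ne e$ (this does not depend on the chosen factorization; one may take $t$ indecomposable). -}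

module Defs where

open import Level using (Level) renaming (suc to lsuc)
open import Algebra.Structures using (IsMonoid)
open import Data.Nat.Base using (ℕ; suc; _+_; _<_; s≤s)
open import Data.Nat.Induction using (<-wellFounded)
open import Data.Nat.Properties using (≤-reflexive; m≤n+m; m+n≡0⇒n≡0)
open import Data.Product.Base using (_×_; _,_; proj₁; proj₂; ∃; ∃₂)
open import Data.Sum.Base using (_⊎_; inj₁; inj₂)
open import Function.Base using (_on_)
open import Induction.WellFounded using (WellFounded; module All; module FixPoint)
open import Relation.Binary.Construct.On as On using ()
open import Relation.Binary.PropositionalEquality
  using (_≡_; _≢_; refl; sym; trans; cong; subst; module ≡-Reasoning)
open import Relation.Nullary using (¬_; contradiction)
open import Relation.Unary using (Pred; _∈_; _∉_; _≐_; ｛_｝)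

private
  variable
    ℓ : Level

-- The disjoint union C = ⨆ₙ Cₙ is represented by its underlying set together
-- with the size function ∣_∣, and Cₙ is the fibre of ∣_∣ over n.
-- The operation written λ in the mathematics is ƛ here (λ is reserved).
record IsCatalanStructure
  (C : Set ℓ) (∣_∣ : C → ℕ) (e : C) (ƛ : C → C) (_⊕_ : C → C → C) : Set ℓ where

  C[_] : ℕ → Pred C _
  C[ n ] t = ∣ t ∣ ≡ n

  Indecomposable : Pred C ℓ
  Indecomposable t = ∃ λ s → t ≡ ƛ s

  Decomposable : Pred C ℓ
  Decomposable t = ∃₂ λ u v → Indecomposable u × v ∉ C[ 0 ] × t ≡ u ⊕ v

  field
    C₀≐｛e｝    : C[ 0 ] ≐ ｛ e ｝
    ƛ-graded   : ∀ {n t} → t ∈ C[ n ] → ƛ t ∈ C[ suc n ]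
    ⊕-graded   : ∀ {m n t u} → t ∈ C[ m ] → u ∈ C[ n ] → (t ⊕ u) ∈ C[ m + n ]
    ⊕-isMonoid : IsMonoid _≡_ _⊕_ e

    -- Every element has one of the three forms, ...
    decompose  : ∀ t → t ≡ e ⊎ Indecomposable t ⊎ Decomposable t
    -- ... no element has two of them, ...
    e-notIndecomposable : ¬ Indecomposable e
    e-notDecomposable   : ¬ Decomposable e
    indecomposable⇒notDecomposable : ∀ {t} → Indecomposable t → ¬ Decomposable t
    -- ... and within each form the constituents are unique.
    ƛ-injective : ∀ {s s′} → ƛ s ≡ ƛ s′ → s ≡ s′
    ⊕-unique    : ∀ {u u′ v v′} →
                  Indecomposable u → v ∉ C[ 0 ] →
                  Indecomposable u′ → v′ ∉ C[ 0 ] →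
                  u ⊕ v ≡ u′ ⊕ v′ → u ≡ u′ × v ≡ v′

record CatalanStructure (ℓ : Level) : Set (lsuc ℓ) where
  field
    C   : Set ℓ
    ∣_∣ : C → ℕ
    e   : C
    ƛ   : C → C
    _⊕_ : C → C → C
    isCatalanStructure : IsCatalanStructure C ∣_∣ e ƛ _⊕_

  infixr 6 _⊕_ _⊖_

  open IsCatalanStructure isCatalanStructure public

  γ : C → C
  γ t = t ⊕ ƛ e

  private
    _≺_ : C → C → Set
    _≺_ = _<_ on ∣_∣

    ≺-wellFounded : WellFounded _≺_
    ≺-wellFounded = On.wellFounded ∣_∣ <-wellFounded

    s≺ƛs : ∀ {t s} → t ≡ ƛ s → s ≺ t
    s≺ƛs {s = s} refl = ≤-reflexive (sym (ƛ-graded {t = s} refl))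

    w≺u⊕w : ∀ {t u w} → Indecomposable u → t ≡ u ⊕ w → w ≺ t
    w≺u⊕w {w = w} (s , refl) refl =
      subst (∣ w ∣ <_) (sym (⊕-graded (ƛ-graded {t = s} refl) refl))
            (s≤s (m≤n+m ∣ w ∣ ∣ s ∣))

    step : C → ∀ t → t ≡ e ⊎ Indecomposable t ⊎ Decomposable t →
           (∀ {s} → s ≺ t → C) → C
    step v t (inj₁ _)                                  rec = v
    step v t (inj₂ (inj₁ (s , t≡ƛs)))                  rec = ƛ (rec (s≺ƛs t≡ƛs))
    step v t (inj₂ (inj₂ (u , w , u-ind , _ , t≡u⊕w))) rec =
      u ⊕ rec (w≺u⊕w u-ind t≡u⊕w)

  -- Well-founded recursion on the size of the first argument, where a
  -- decomposable t is split as u ⊕ w with u indecomposable.  That the defining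
  -- equations hold, for arbitrary factorizations, is ⊖-e, ⊖-ƛ and ⊖-⊕ below.
  _⊖_ : C → C → C
  t ⊖ v = All.wfRec ≺-wellFounded ℓ (λ _ → C) (λ t → step v t (decompose t)) t

  private
    step-ext : ∀ v t d {rec rec′ : ∀ {s} → s ≺ t → C} →
               (∀ {s} (s≺t : s ≺ t) → rec s≺t ≡ rec′ s≺t) →
               step v t d rec ≡ step v t d rec′
    step-ext v t (inj₁ _)                eq = refl
    step-ext v t (inj₂ (inj₁ _))         eq = cong ƛ (eq _)
    step-ext v t (inj₂ (inj₂ (u , _)))   eq = cong (u ⊕_) (eq _)

    ⊖-unfold : ∀ t v → t ⊖ v ≡ step v t (decompose t) (λ {s} _ → s ⊖ v)
    ⊖-unfold t v = FixPoint.unfold-wfRec ≺-wellFounded (λ _ → C)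
      (λ t → step v t (decompose t)) (λ t → step-ext v t (decompose t))

    ∉C₀ : ∀ {t} → t ≢ e → t ∉ C[ 0 ]
    ∉C₀ t≢e ∣t∣≡0 = t≢e (sym (proj₁ C₀≐｛e｝ ∣t∣≡0))

    ⊕-≢e : ∀ {t u} → u ≢ e → t ⊕ u ≢ e
    ⊕-≢e {t} u≢e t⊕u≡e = ∉C₀ u≢e (m+n≡0⇒n≡0 ∣ t ∣
      (trans (sym (⊕-graded refl refl)) (proj₂ C₀≐｛e｝ (sym t⊕u≡e))))

  ⊖-e : ∀ v → e ⊖ v ≡ v
  ⊖-e v = trans (⊖-unfold e v) (go (decompose e))
    where
    go : ∀ d → step v e d (λ {s} _ → s ⊖ v) ≡ v
    go (inj₁ _)          = refl
    go (inj₂ (inj₁ ind)) = contradiction ind e-notIndecomposable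
    go (inj₂ (inj₂ dec)) = contradiction dec e-notDecomposable

  ⊖-ƛ : ∀ u v → ƛ u ⊖ v ≡ ƛ (u ⊖ v)
  ⊖-ƛ u v = trans (⊖-unfold (ƛ u) v) (go (decompose (ƛ u)))
    where
    go : ∀ d → step v (ƛ u) d (λ {s} _ → s ⊖ v) ≡ ƛ (u ⊖ v)
    go (inj₁ ƛu≡e)              = contradiction (u , sym ƛu≡e) e-notIndecomposable
    go (inj₂ (inj₁ (s , ƛu≡ƛs))) = cong (λ s → ƛ (s ⊖ v)) (sym (ƛ-injective ƛu≡ƛs))
    go (inj₂ (inj₂ dec))        =
      contradiction dec (indecomposable⇒notDecomposable (u , refl))

  private
    ⊖-⊕-ind : ∀ t u v → Indecomposable t → u ≢ e → (t ⊕ u) ⊖ v ≡ t ⊕ (u ⊖ v)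
    ⊖-⊕-ind t u v t-ind u≢e = trans (⊖-unfold (t ⊕ u) v) (go (decompose (t ⊕ u)))
      where
      t⊕u-dec : Decomposable (t ⊕ u)
      t⊕u-dec = t , u , t-ind , ∉C₀ u≢e , refl

      go : ∀ d → step v (t ⊕ u) d (λ {s} _ → s ⊖ v) ≡ t ⊕ (u ⊖ v)
      go (inj₁ t⊕u≡e)      = contradiction t⊕u≡e (⊕-≢e u≢e)
      go (inj₂ (inj₁ ind)) = contradiction t⊕u-dec (indecomposable⇒notDecomposable ind)
      go (inj₂ (inj₂ (a , b , a-ind , b∉C₀ , eq)))
        with refl , refl ← ⊕-unique t-ind (∉C₀ u≢e) a-ind b∉C₀ eq = refl

  ⊖-⊕ : ∀ t u v → t ≢ e → u ≢ e → (t ⊕ u) ⊖ v ≡ t ⊕ (u ⊖ v)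
  ⊖-⊕ = All.wfRec ≺-wellFounded ℓ P λ t rec → go t rec (decompose t)
    where
    open IsMonoid ⊕-isMonoid using (assoc)
    open ≡-Reasoning

    P : C → Set ℓ
    P t = ∀ u v → t ≢ e → u ≢ e → (t ⊕ u) ⊖ v ≡ t ⊕ (u ⊖ v)

    go : ∀ t → (∀ {s} → s ≺ t → P s) → t ≡ e ⊎ Indecomposable t ⊎ Decomposable t → P t
    go t rec (inj₁ t≡e)          u v t≢e u≢e = contradiction t≡e t≢e
    go t rec (inj₂ (inj₁ t-ind)) u v t≢e u≢e = ⊖-⊕-ind t u v t-ind u≢e
    go t rec (inj₂ (inj₂ (a , b , a-ind , b∉C₀ , refl))) u v t≢e u≢e = begin
      ((a ⊕ b) ⊕ u) ⊖ v  ≡⟨ cong (_⊖ v) (assoc a b u) ⟩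
      (a ⊕ (b ⊕ u)) ⊖ v  ≡⟨ ⊖-⊕-ind a (b ⊕ u) v a-ind (⊕-≢e u≢e) ⟩
      a ⊕ ((b ⊕ u) ⊖ v)  ≡⟨ cong (a ⊕_) (rec (w≺u⊕w a-ind refl) u v b≢e u≢e) ⟩
      a ⊕ (b ⊕ (u ⊖ v))  ≡⟨ sym (assoc a b (u ⊖ v)) ⟩
      (a ⊕ b) ⊕ (u ⊖ v)  ∎
      where
      b≢e : b ≢ e
      b≢e b≡e = b∉C₀ (proj₂ C₀≐｛e｝ (sym b≡e))

{-# OPTIONS --safe #-}
-- Every element other than e is s ⊕ ƛ v for unique s and v, and in terms of
-- this last-factor decomposition (s ⊕ ƛ v) ⊖ w = s ⊕ ƛ (v ⊖ w).  Hence
-- γ s = s ⊕ ƛ e and γ s ⊖ v = s ⊕ ƛ v: the two nontrivial forms for (γ , ⊖) are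
-- the cases v = e and v ≠ e of the decomposition, and the laws of ⊖ follow by
-- induction on v.
module Submission where

open import Defs

open import Algebra.Structures using (IsMonoid)
open import Data.Nat.Base using (suc; _+_; _<_; s≤s)
open import Data.Nat.Induction using (<-wellFounded)
open import Data.Nat.Properties using (+-assoc; +-suc; +-identityʳ; m≤n+m; 1+n≢0)
open import Data.Product.Base using (_×_; _,_; proj₁; proj₂; ∃; ∃₂)
open import Data.Sum.Base using (_⊎_; inj₁; inj₂)
open import Function.Base using (_on_; case_of_)
open import Induction.WellFounded using (WellFounded; module All)
open import Relation.Binary.Construct.On as On using ()
open import Relation.Binary.PropositionalEquality
  using (_≡_; _≢_; refl; sym; trans; cong; cong₂; subst; isEquivalence; module ≡-Reasoning)
open import Relation.Nullary using (contradiction)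
open import Relation.Unary using (_∉_)

module SecondaryStructure {ℓ} (S : CatalanStructure ℓ) where
  open CatalanStructure S
  open IsMonoid ⊕-isMonoid using (assoc; identityˡ; identityʳ)
  open ≡-Reasoning

  _≺_ : C → C → Set
  _≺_ = _<_ on ∣_∣

  ≺-wellFounded : WellFounded _≺_
  ≺-wellFounded = On.wellFounded ∣_∣ <-wellFounded

  ∣e∣≡0 : ∣ e ∣ ≡ 0
  ∣e∣≡0 = proj₂ C₀≐｛e｝ refl

  ∣ƛ⊕∣ : ∀ a w → ∣ ƛ a ⊕ w ∣ ≡ suc (∣ a ∣ + ∣ w ∣)
  ∣ƛ⊕∣ a w = ⊕-graded (ƛ-graded refl) refl

  ∣⊕ƛ∣ : ∀ s v → ∣ s ⊕ ƛ v ∣ ≡ suc (∣ s ∣ + ∣ v ∣)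
  ∣⊕ƛ∣ s v = trans (⊕-graded refl (ƛ-graded refl)) (+-suc ∣ s ∣ ∣ v ∣)

  ⊕ƛ∉C₀ : ∀ s v → s ⊕ ƛ v ∉ C[ 0 ]
  ⊕ƛ∉C₀ s v ∣t∣≡0 = 1+n≢0 (trans (sym (∣⊕ƛ∣ s v)) ∣t∣≡0)

  e≢⊕ƛ : ∀ s v → e ≢ s ⊕ ƛ v
  e≢⊕ƛ s v eq = ⊕ƛ∉C₀ s v (proj₂ C₀≐｛e｝ eq)

  -- The tail `s ⊕ ƛ v` has positive size, so the right side is decomposable while the left is
  -- indecomposable.
  ƛ≢ƛ⊕⊕ƛ : ∀ a b s v → ƛ a ≢ ƛ b ⊕ (s ⊕ ƛ v)
  ƛ≢ƛ⊕⊕ƛ a b s v eq = indecomposable⇒notDecomposable (a , refl)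
    (ƛ b , s ⊕ ƛ v , (b , refl) , ⊕ƛ∉C₀ s v , eq)

  -- Allowing `w` to be `e` merges the indecomposable and decomposable forms into one case.
  firstFactor : ∀ t → t ≡ e ⊎ ∃₂ λ a w → t ≡ ƛ a ⊕ w
  firstFactor t with decompose t
  ... | inj₁ t≡e = inj₁ t≡e
  ... | inj₂ (inj₁ (a , t≡ƛa)) = inj₂ (a , e , trans t≡ƛa (sym (identityʳ (ƛ a))))
  ... | inj₂ (inj₂ (_ , w , (a , refl) , _ , t≡ƛa⊕w)) = inj₂ (a , w , t≡ƛa⊕w)

  ƛ⊕-induction : ∀ {p} (P : C → Set p) → P e → (∀ a w → P w → P (ƛ a ⊕ w)) → ∀ t → P t
  ƛ⊕-induction {p} P P-e P-ƛ⊕ = All.wfRec ≺-wellFounded p P step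
    where
    step : ∀ t → (∀ {w} → w ≺ t → P w) → P t
    step t rec with firstFactor t
    ... | inj₁ refl = P-e
    ... | inj₂ (a , w , refl) = P-ƛ⊕ a w (rec
      (subst (∣ w ∣ <_) (sym (∣ƛ⊕∣ a w)) (s≤s (m≤n+m ∣ w ∣ ∣ a ∣))))

  -- First factors are peeled off and, by associativity, collected in `s`, until the remainder is
  -- `e`; the factor peeled last is `ƛ v`.
  lastFactor : ∀ t → t ≡ e ⊎ ∃₂ λ s v → t ≡ s ⊕ ƛ v
  lastFactor = ƛ⊕-induction _ (inj₁ refl) step
    where
    step : ∀ a w → w ≡ e ⊎ (∃₂ λ s v → w ≡ s ⊕ ƛ v) →
           ƛ a ⊕ w ≡ e ⊎ ∃₂ λ s v → ƛ a ⊕ w ≡ s ⊕ ƛ v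
    step a w (inj₁ refl) = inj₂ (e , a , trans (identityʳ (ƛ a)) (sym (identityˡ (ƛ a))))
    step a w (inj₂ (s , v , refl)) = inj₂ (ƛ a ⊕ s , v , sym (assoc (ƛ a) s (ƛ v)))

  -- The hypothesis is for `v` and not for `s`, because `⊖` acts inside the last `ƛ` and leaves `s`
  -- unchanged.
  ⊕ƛ-induction : ∀ {p} (P : C → Set p) → P e → (∀ s v → P v → P (s ⊕ ƛ v)) → ∀ t → P t
  ⊕ƛ-induction {p} P P-e P-⊕ƛ = All.wfRec ≺-wellFounded p P step
    where
    step : ∀ t → (∀ {v} → v ≺ t → P v) → P t
    step t rec with lastFactor t
    ... | inj₁ refl = P-e
    ... | inj₂ (s , v , refl) = P-⊕ƛ s v (rec
      (subst (∣ v ∣ <_) (sym (∣⊕ƛ∣ s v)) (s≤s (m≤n+m ∣ v ∣ ∣ s ∣))))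

  -- Equal first factors are cancelled from both sides by `⊕-unique`. If one of `s`, `s′` is
  -- exhausted before the other, an indecomposable element equals a decomposable one.
  ⊕ƛ-unique : ∀ s s′ {v v′} → s ⊕ ƛ v ≡ s′ ⊕ ƛ v′ → s ≡ s′ × v ≡ v′
  ⊕ƛ-unique = ƛ⊕-induction _ base step
    where
    base : ∀ s′ {v v′} → e ⊕ ƛ v ≡ s′ ⊕ ƛ v′ → e ≡ s′ × v ≡ v′
    base s′ {v} {v′} eq with firstFactor s′
    ... | inj₁ refl = refl ,
      ƛ-injective (trans (sym (identityˡ (ƛ v))) (trans eq (identityˡ (ƛ v′))))
    ... | inj₂ (b , w , refl) = contradiction
      (trans (sym (identityˡ (ƛ v))) (trans eq (assoc (ƛ b) w (ƛ v′))))
      (ƛ≢ƛ⊕⊕ƛ v b w v′)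

    step : ∀ a w → (∀ s′ {v v′} → w ⊕ ƛ v ≡ s′ ⊕ ƛ v′ → w ≡ s′ × v ≡ v′) →
           ∀ s′ {v v′} → (ƛ a ⊕ w) ⊕ ƛ v ≡ s′ ⊕ ƛ v′ → ƛ a ⊕ w ≡ s′ × v ≡ v′
    step a w ih s′ {v} {v′} eq with firstFactor s′
    ... | inj₁ refl = contradiction
      (trans (sym (identityˡ (ƛ v′))) (trans (sym eq) (assoc (ƛ a) w (ƛ v))))
      (ƛ≢ƛ⊕⊕ƛ v′ a w v)
    -- Reassociating puts `ƛ a` and `ƛ b` in front of tails that end in `ƛ v` and `ƛ v′` and so have
    -- positive size.
    ... | inj₂ (b , w′ , refl) with ⊕-unique (a , refl) (⊕ƛ∉C₀ w v) (b , refl) (⊕ƛ∉C₀ w′ v′)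
      (trans (sym (assoc (ƛ a) w (ƛ v))) (trans eq (assoc (ƛ b) w′ (ƛ v′))))
    ... | ƛa≡ƛb , w⊕ƛv≡w′⊕ƛv′ with ih w′ w⊕ƛv≡w′⊕ƛv′
    ... | w≡w′ , v≡v′ = cong₂ _⊕_ ƛa≡ƛb w≡w′ , v≡v′

  -- The split on `s` is needed because `⊖-⊕` applies only to factors other than `e`; for `s = e`
  -- the rule `⊖-ƛ` takes over.
  ⊕ƛ-⊖ : ∀ s v w → (s ⊕ ƛ v) ⊖ w ≡ s ⊕ ƛ (v ⊖ w)
  ⊕ƛ-⊖ s v w with lastFactor s
  ... | inj₁ refl = begin
    (e ⊕ ƛ v) ⊖ w    ≡⟨ cong (_⊖ w) (identityˡ (ƛ v)) ⟩
    ƛ v ⊖ w          ≡⟨ ⊖-ƛ v w ⟩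
    ƛ (v ⊖ w)        ≡⟨ sym (identityˡ (ƛ (v ⊖ w))) ⟩
    e ⊕ ƛ (v ⊖ w)    ∎
  ... | inj₂ (a , b , refl) = begin
    ((a ⊕ ƛ b) ⊕ ƛ v) ⊖ w  ≡⟨ ⊖-⊕ (a ⊕ ƛ b) (ƛ v) w (λ eq → e≢⊕ƛ a b (sym eq))
                                  (λ eq → e-notIndecomposable (v , sym eq)) ⟩
    (a ⊕ ƛ b) ⊕ (ƛ v ⊖ w)  ≡⟨ cong ((a ⊕ ƛ b) ⊕_) (⊖-ƛ v w) ⟩
    (a ⊕ ƛ b) ⊕ ƛ (v ⊖ w)  ∎

  γ-⊖ : ∀ s v → γ s ⊖ v ≡ s ⊕ ƛ v
  γ-⊖ s v = trans (⊕ƛ-⊖ s e v) (cong (λ w → s ⊕ ƛ w) (⊖-e v))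

  ∣⊖∣ : ∀ t u → ∣ t ⊖ u ∣ ≡ ∣ t ∣ + ∣ u ∣
  ∣⊖∣ = ⊕ƛ-induction _ base step
    where
    base : ∀ u → ∣ e ⊖ u ∣ ≡ ∣ e ∣ + ∣ u ∣
    base u = trans (cong ∣_∣ (⊖-e u)) (sym (cong (_+ ∣ u ∣) ∣e∣≡0))

    step : ∀ s v → (∀ u → ∣ v ⊖ u ∣ ≡ ∣ v ∣ + ∣ u ∣) →
           ∀ u → ∣ (s ⊕ ƛ v) ⊖ u ∣ ≡ ∣ s ⊕ ƛ v ∣ + ∣ u ∣
    step s v ih u = begin
      ∣ (s ⊕ ƛ v) ⊖ u ∣                ≡⟨ cong ∣_∣ (⊕ƛ-⊖ s v u) ⟩
      ∣ s ⊕ ƛ (v ⊖ u) ∣                ≡⟨ ∣⊕ƛ∣ s (v ⊖ u) ⟩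
      suc (∣ s ∣ + ∣ v ⊖ u ∣)          ≡⟨ cong (λ n → suc (∣ s ∣ + n)) (ih u) ⟩
      suc (∣ s ∣ + (∣ v ∣ + ∣ u ∣))    ≡⟨ cong suc (sym (+-assoc (∣ s ∣) (∣ v ∣) (∣ u ∣))) ⟩
      suc (∣ s ∣ + ∣ v ∣) + ∣ u ∣      ≡⟨ cong (_+ ∣ u ∣) (sym (∣⊕ƛ∣ s v)) ⟩
      ∣ s ⊕ ƛ v ∣ + ∣ u ∣              ∎

  ⊖-identityʳ : ∀ t → t ⊖ e ≡ t
  ⊖-identityʳ = ⊕ƛ-induction _ (⊖-e e)
    λ s v ih → trans (⊕ƛ-⊖ s v e) (cong (λ w → s ⊕ ƛ w) ih)

  ⊖-assoc : ∀ t u w → (t ⊖ u) ⊖ w ≡ t ⊖ (u ⊖ w)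
  ⊖-assoc = ⊕ƛ-induction _ base step
    where
    base : ∀ u w → (e ⊖ u) ⊖ w ≡ e ⊖ (u ⊖ w)
    base u w = trans (cong (_⊖ w) (⊖-e u)) (sym (⊖-e (u ⊖ w)))

    step : ∀ s v → (∀ u w → (v ⊖ u) ⊖ w ≡ v ⊖ (u ⊖ w)) →
           ∀ u w → ((s ⊕ ƛ v) ⊖ u) ⊖ w ≡ (s ⊕ ƛ v) ⊖ (u ⊖ w)
    step s v ih u w = begin
      ((s ⊕ ƛ v) ⊖ u) ⊖ w    ≡⟨ cong (_⊖ w) (⊕ƛ-⊖ s v u) ⟩
      (s ⊕ ƛ (v ⊖ u)) ⊖ w    ≡⟨ ⊕ƛ-⊖ s (v ⊖ u) w ⟩
      s ⊕ ƛ ((v ⊖ u) ⊖ w)    ≡⟨ cong (λ x → s ⊕ ƛ x) (ih u w) ⟩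
      s ⊕ ƛ (v ⊖ (u ⊖ w))    ≡⟨ sym (⊕ƛ-⊖ s v (u ⊖ w)) ⟩
      (s ⊕ ƛ v) ⊖ (u ⊖ w)    ∎

  ⊖-isMonoid : IsMonoid _≡_ _⊖_ e
  ⊖-isMonoid = record
    { isSemigroup = record
      { isMagma = record { isEquivalence = isEquivalence ; ∙-cong = cong₂ _⊖_ }
      ; assoc   = ⊖-assoc
      }
    ; identity = ⊖-e , ⊖-identityʳ
    }

  ∣γ∣ : ∀ t → ∣ γ t ∣ ≡ suc ∣ t ∣
  ∣γ∣ t = trans (∣⊕ƛ∣ t e)
    (cong suc (trans (cong (∣ t ∣ +_) ∣e∣≡0) (+-identityʳ ∣ t ∣)))

  γ-⊖-decompose : ∀ t → t ≡ e ⊎ (∃ λ s → t ≡ γ s) ⊎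
                  ∃₂ λ s v → v ∉ C[ 0 ] × t ≡ γ s ⊖ v
  γ-⊖-decompose t with lastFactor t
  ... | inj₁ t≡e = inj₁ t≡e
  -- This second split decides whether `v` is `e`, and otherwise exhibits `v` as an element of
  -- positive size.
  ... | inj₂ (s , v , t≡s⊕ƛv) with lastFactor v
  ...   | inj₁ refl = inj₂ (inj₁ (s , t≡s⊕ƛv))
  ...   | inj₂ (a , b , refl) =
    inj₂ (inj₂ (s , v , ⊕ƛ∉C₀ a b , trans t≡s⊕ƛv (sym (γ-⊖ s v))))

  -- Comparing the last factors `ƛ e` and `ƛ v` of the two sides would force `v = e`.
  γ≢γ-⊖ : ∀ s s′ v → v ∉ C[ 0 ] → γ s ≢ γ s′ ⊖ v
  γ≢γ-⊖ s s′ v v∉C₀ eq =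
    v∉C₀ (proj₂ C₀≐｛e｝ (proj₂ (⊕ƛ-unique s s′ (trans eq (γ-⊖ s′ v)))))

  γ-⊖-unique : ∀ s s′ {v v′} → γ s ⊖ v ≡ γ s′ ⊖ v′ → s ≡ s′ × v ≡ v′
  γ-⊖-unique s s′ {v} {v′} eq =
    ⊕ƛ-unique s s′ (trans (sym (γ-⊖ s v)) (trans eq (γ-⊖ s′ v′)))

proposition2p4 : ∀ {ℓ} (S : CatalanStructure ℓ) →
    let open CatalanStructure S in
    IsCatalanStructure C ∣_∣ e γ _⊖_
proposition2p4 S = record
  { C₀≐｛e｝    = C₀≐｛e｝
  ; ƛ-graded   = λ {_} {t} → λ { refl → ∣γ∣ t }
  ; ⊕-graded   = λ {_} {_} {t} {u} → λ { refl refl → ∣⊖∣ t u }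
  ; ⊕-isMonoid = ⊖-isMonoid
  ; decompose  = λ t → case γ-⊖-decompose t of λ
      { (inj₁ t≡e)                           → inj₁ t≡e
      ; (inj₂ (inj₁ t-ind))                  → inj₂ (inj₁ t-ind)
      ; (inj₂ (inj₂ (s , v , v∉C₀ , t≡γs⊖v))) →
          inj₂ (inj₂ (γ s , v , (s , refl) , v∉C₀ , t≡γs⊖v))
      }
  ; e-notIndecomposable = λ { (s , e≡γs) → e≢⊕ƛ s e e≡γs }
  ; e-notDecomposable   =
      λ { (_ , v , (s , refl) , _ , e≡γs⊖v) → e≢⊕ƛ s v (trans e≡γs⊖v (γ-⊖ s v)) }
  ; indecomposable⇒notDecomposable =
      λ { (s , refl) (_ , v , (s′ , refl) , v∉C₀ , eq) → γ≢γ-⊖ s s′ v v∉C₀ eq }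
  -- Since `γ s` unfolds to `s ⊕ ƛ e`, this is uniqueness of the last-factor decomposition with both
  -- last factors equal to `ƛ e`.
  ; ƛ-injective = λ {s} {s′} eq → proj₁ (⊕ƛ-unique s s′ eq)
  ; ⊕-unique    = λ { (s , refl) _ (s′ , refl) _ eq →
      let s≡s′ , v≡v′ = γ-⊖-unique s s′ eq in cong γ s≡s′ , v≡v′ }
  }
  where
  open CatalanStructure S
  open SecondaryStructure S
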